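{- Let $X$ be a connected irreducible circulant of odd order and let $B(X)$ be its canonical double cover. Then $\mathrm{Aut}(B(X))\cong \mathrm{Aut}(X)\times \mathbb{Z}_2$.
   Context: All groups and graphs are finite; all graphs are simple and undirected. For a graph $X$, $V(X)$, $E(X)$ and $\mathrm{Aut}(X)$ denote its vertex set, edge set and automorphism group. For a group $G$ and an inverse-closed subset $S\subseteq G\setminus\{1_G\}$, the Cayley graph $\mathrm{Cay}(G,S)$ has vertex set $G$, with $x,y\in G$ adjacent if and only if $x^{ -1}y\in S$. A circulant is a Cayley graph on a cyclic group; the order of a graph is its number of vertices. A graph is irreducible if distinct vertices have different neighbourhoods (sets of neighbours). The canonical double cover $B(X)$ of a graph $X$ is the direct product $X\times K_2$: it has vertex set $V(X)\times\mathbb{Z}_2$ and edge set $\{\{(x,0),(y,1)\} : \{x,y\}\in E(X)\}$, where both $\{(x,0),(y,1)\}$ and $\{(y,0),(x,1)\}$ are edges for each edge $\{x,y\}$ of $X$. -}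

module Defs where

open import Algebra.Bundles using (Group)
open import Algebra.Morphism.Structures using (module GroupMorphisms)
open import Algebra.Structures using (IsGroup)
import Algebra.Definitions.RawMonoid as RawMonoidMult
import Algebra.Properties.Group as GroupProperties
open import Data.Fin.Base using (Fin)
open import Data.Fin.Patterns using (0F; 1F)
open import Data.Fin.Properties using (*↔×)
open import Data.Integer.Base using (ℤ; +_; -[1+_])
open import Data.Nat.Base using (ℕ; suc; _*_)
open import Data.Nat.Divisibility using (_∣_)
open import Data.Parity.Base using (Parity; 0ℙ; 1ℙ)
open import Data.Parity.Properties using (_≟_; +-0-group)
open import Data.Product.Base using (_×_; _,_; ∃-syntax)
open import Data.Product.Function.NonDependent.Propositional using (_×-↔_)
open import Function.Base using (_∘_)
open import Function.Bundles using (_↔_; _⇔_; mk⇔; mk↔ₛ′; module Inverse; module Equivalence)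
open import Function.Construct.Composition using (_↔-∘_)
open import Function.Construct.Identity using (↔-id; ⇔-id)
open import Function.Construct.Symmetry using (↔-sym)
open import Level using (0ℓ)
open import Relation.Binary.Construct.Closure.ReflexiveTransitive using (Star)
open import Relation.Binary.PropositionalEquality
  using (_≡_; _≢_; refl; sym; trans; cong; subst; subst₂; ≢-sym)
open import Relation.Nullary.Decidable using (_×-dec_; ¬?)
open import Relation.Nullary.Negation using (¬_)
import Relation.Binary.Definitions as Binary
open import Relation.Unary using (Pred; Decidable; _≐_)
import Algebra.Construct.DirectProduct as DirectProduct

------------------------------------------------------------------------
-- Groups

record FiniteGroup : Set₁ where
  infixl 7 _∙_
  infix  8 _⁻¹
  field
    Carrier : Set
    _∙_     : Carrier → Carrier → Carrier
    ε       : Carrier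
    _⁻¹     : Carrier → Carrier
    isGroup : IsGroup _≡_ _∙_ ε _⁻¹
    order   : ℕ
    finite  : Carrier ↔ Fin order

  group : Group 0ℓ 0ℓ
  group = record { isGroup = isGroup }

  open RawMonoidMult (Group.rawMonoid group) using () renaming (_×_ to infixr 8 _times_)

  infixr 8 _^_
  _^_ : Carrier → ℤ → Carrier
  g ^ (+ n)    = n times g
  g ^ -[1+ n ] = (suc n times g) ⁻¹

Cyclic : FiniteGroup → Set
Cyclic G = ∃[ g ] ∀ x → ∃[ k ] x ≡ g ^ k
  where open FiniteGroup G

infix 4 _≅_
_≅_ : Group 0ℓ 0ℓ → Group 0ℓ 0ℓ → Set
G ≅ H = ∃[ f ] IsGroupIsomorphism f
  where open GroupMorphisms (Group.rawGroup G) (Group.rawGroup H)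

infixr 7 _×ᴳ_
_×ᴳ_ : Group 0ℓ 0ℓ → Group 0ℓ 0ℓ → Group 0ℓ 0ℓ
_×ᴳ_ = DirectProduct.group

ℤ₂ : Group 0ℓ 0ℓ
ℤ₂ = +-0-group

------------------------------------------------------------------------
-- Graphs

-- Decidability of adjacency makes the edge set a genuine finite set;
-- classically it is automatic.
record Graph : Set₁ where
  field
    Vertex : Set
    order  : ℕ
    finite : Vertex ↔ Fin order
    Adj    : Vertex → Vertex → Set
    adj?   : Binary.Decidable Adj
    irrefl : ∀ {x} → ¬ Adj x x
    symm   : ∀ {x y} → Adj x y → Adj y x

OddOrder : Graph → Set
OddOrder X = ¬ (2 ∣ Graph.order X)

Connected : Graph → Set
Connected X = ∀ x y → Star Adj x y
  where open Graph X

-- The neighbourhood of x is the predicate Adj x; _≐_ is equality of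
-- subsets.
Irreducible : Graph → Set
Irreducible X = ∀ x y → x ≢ y → ¬ (Adj x ≐ Adj y)
  where open Graph X

record Automorphism (X : Graph) : Set where
  open Graph X
  field
    bijection : Vertex ↔ Vertex
  open Inverse bijection public using (to; from; strictlyInverseˡ; strictlyInverseʳ)
  field
    preserves : ∀ x y → Adj x y ⇔ Adj (to x) (to y)

-- Automorphisms are equal when they agree at every vertex, and the
-- product is composition of maps.
Aut : Graph → Group 0ℓ 0ℓ
Aut X = record
  { Carrier = Automorphism X
  ; _≈_     = λ α β → ∀ x → to α x ≡ to β x
  ; _∙_     = _⊙_
  ; ε       = identity
  ; _⁻¹     = inverse
  ; isGroup = record
    { isMonoid = record
      { isSemigroup = record
        { isMagma = record
          { isEquivalence = record
            { refl  = λ _ → refl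
            ; sym   = λ p x → sym (p x)
            ; trans = λ p q x → trans (p x) (q x)
            }
          ; ∙-cong = λ {α} {β} {γ} {δ} p q x → trans (cong (to α) (q x)) (p (to δ x))
          }
        ; assoc = λ _ _ _ _ → refl
        }
      ; identity = (λ _ _ → refl) , (λ _ _ → refl)
      }
    ; inverse = strictlyInverseʳ , strictlyInverseˡ
    ; ⁻¹-cong = λ {α} {β} p x →
        trans (cong (from α) (sym (trans (p (from β x)) (strictlyInverseˡ β x))))
              (strictlyInverseʳ α (from β x))
    }
  }
  where
  open Graph X
  open Automorphism

  _⊙_ : Automorphism X → Automorphism X → Automorphism X
  α ⊙ β = record
    { bijection = mk↔ₛ′ (to α ∘ to β) (from β ∘ from α)
        (λ x → trans (cong (to α) (strictlyInverseˡ β (from α x))) (strictlyInverseˡ α x))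
        (λ x → trans (cong (from β) (strictlyInverseʳ α (to β x))) (strictlyInverseʳ β x))
    ; preserves = λ x y → mk⇔
        (Equivalence.to (preserves α _ _) ∘ Equivalence.to (preserves β x y))
        (Equivalence.from (preserves β x y) ∘ Equivalence.from (preserves α _ _))
    }

  identity : Automorphism X
  identity = record { bijection = ↔-id _ ; preserves = λ _ _ → ⇔-id _ }

  inverse : Automorphism X → Automorphism X
  inverse α = record
    { bijection = ↔-sym (bijection α)
    ; preserves = λ x y → mk⇔
        (λ e → Equivalence.from (preserves α _ _)
          (subst₂ Adj (sym (strictlyInverseˡ α x)) (sym (strictlyInverseˡ α y)) e))
        (λ e → subst₂ Adj (strictlyInverseˡ α x) (strictlyInverseˡ α y)
          (Equivalence.to (preserves α _ _) e))
    }

------------------------------------------------------------------------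
-- Cayley graphs

-- An inverse-closed subset of G ∖ {ε}.
record ConnectionSet (G : FiniteGroup) : Set₁ where
  open FiniteGroup G
  field
    S         : Pred Carrier 0ℓ
    S?        : Decidable S
    ε∉S       : ¬ S ε
    ⁻¹-closed : ∀ {s} → S s → S (s ⁻¹)

Cay : (G : FiniteGroup) → ConnectionSet G → Graph
Cay G C = record
  { Vertex = Carrier
  ; order  = order
  ; finite = finite
  ; Adj    = λ x y → S (x ⁻¹ ∙ y)
  ; adj?   = λ x y → S? (x ⁻¹ ∙ y)
  ; irrefl = λ {x} e → ε∉S (subst S (Group.inverseˡ group x) e)
  ; symm   = λ {x} {y} e → subst S (⁻¹-anti-homo-\\ x y) (⁻¹-closed e)
  }
  where
  open FiniteGroup G
  open ConnectionSet C
  open GroupProperties group using (⁻¹-anti-homo-\\)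

------------------------------------------------------------------------
-- The canonical double cover

K₂ : Graph
K₂ = record
  { Vertex = Parity
  ; order  = 2
  ; finite = mk↔ₛ′ (λ { 0ℙ → 0F ; 1ℙ → 1F }) (λ { 0F → 0ℙ ; 1F → 1ℙ })
                   (λ { 0F → refl ; 1F → refl }) (λ { 0ℙ → refl ; 1ℙ → refl })
  ; Adj    = _≢_
  ; adj?   = λ i j → ¬? (i ≟ j)
  ; irrefl = λ i≢i → i≢i refl
  ; symm   = ≢-sym
  }

infixr 7 _⊗_
_⊗_ : Graph → Graph → Graph
X ⊗ Y = record
  { Vertex = X.Vertex × Y.Vertex
  ; order  = X.order * Y.order
  ; finite = ↔-sym *↔× ↔-∘ (X.finite ×-↔ Y.finite)
  ; Adj    = λ (x , i) (y , j) → X.Adj x y × Y.Adj i j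
  ; adj?   = λ (x , i) (y , j) → X.adj? x y ×-dec Y.adj? i j
  ; irrefl = λ (e , _) → X.irrefl e
  ; symm   = λ (e , f) → X.symm e , Y.symm f
  }
  where
  module X = Graph X
  module Y = Graph Y

-- (x , i) and (y , j) are adjacent iff x and y are adjacent in X and
-- i ≢ j, i.e. {i , j} = {0ℙ , 1ℙ}.
B : Graph → Graph
B X = X ⊗ K₂

{-# OPTIONS --safe #-}
module Submission where

-- Work with adjacency matrices over F₂. In an abelian group the walks x, z, y of length two in a
-- Cayley graph cancel in pairs under reversal of their two steps, except those with equal steps.
-- As squaring is injective in odd order, the square of the adjacency matrix of
-- Cay(G × ℤ₂, S × {c}) is therefore that of Cay(G × ℤ₂, S² × {2c}), where S² = {s² : s ∈ S}.
-- Some positive iterate of squaring is the identity of G, so every automorphism of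
-- B(X) = Cay(G × ℤ₂, S × {1}) is one of Cay(G × ℤ₂, S × {0}), that is, of two disjoint copies of X.
-- By connectedness it permutes the two layers, and by irreducibility it acts in the same way on both.

open import Defs

open import Algebra.Bundles using (AbelianGroup; Group)
import Algebra.Definitions.RawMonoid as RawMonoidMult
open import Algebra.Morphism.Structures using (module GroupMorphisms)
import Algebra.Properties.AbelianGroup as AbelianGroupProperties
import Algebra.Properties.CommutativeMonoid.Sum as SumProperties
import Algebra.Properties.CommutativeSemigroup as CommutativeSemigroupProperties
import Algebra.Properties.Group as GroupProperties
open import Data.Fin.Base using (Fin; toℕ)
open import Data.Fin.Permutation using (permutation)
open import Data.Fin.Properties as Fin using (pigeonhole; inj⇒≟; punchInᵢ≢i)
open import Data.Integer.Base using (+_; -[1+_])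
open import Data.Nat.Base as ℕ using (ℕ; zero; suc)
open import Data.Nat.Divisibility using (_∣_; _∣0; ∣m∣n⇒∣m+n; ∣-refl)
import Data.Nat.Properties as ℕ
open import Data.Parity.Base using (Parity; 0ℙ; 1ℙ; _+_; _*_)
open import Data.Parity.Properties as ℙ using (p+p≡0ℙ)
open import Data.Product.Base using (_×_; _,_; proj₁; proj₂; ∃-syntax)
open import Data.Sum.Base using (_⊎_; inj₁; inj₂)
open import Function.Base using (_∘_; const)
open import Function.Bundles
  using (_↔_; _⇔_; mk⇔; mk↔ₛ′; module Injection; module Inverse; module Equivalence)
open import Function.Construct.Composition using (_⇔-∘_)
open import Function.Construct.Symmetry using (⇔-sym)
open import Function.Definitions using (Injective)
import Function.Endo.Propositional as Endo
open import Function.Properties.Inverse using (↔⇒↣)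
open import Level using (0ℓ)
open import Relation.Binary.Construct.Closure.ReflexiveTransitive using (fold)
open import Relation.Binary.Definitions using (tri<; tri≈; tri>)
open import Relation.Binary.PropositionalEquality
  using (_≡_; _≢_; refl; sym; trans; cong; cong₂; module ≡-Reasoning)
open import Relation.Nullary.Decidable using (Dec; yes; no; decidable-stable)
open import Relation.Nullary.Negation using (¬_; contradiction)
open SumProperties ℙ.+-0-commutativeMonoid
  using (sum; sum-cong-≗; sum-permute; ∑-distrib-+; sum-remove; sum-replicate; sum-replicate-zero)
open RawMonoidMult (Group.rawMonoid ℙ.+-0-group) using () renaming (_×_ to _timesℙ_)
open ≡-Reasoning

-- Sums over finite sets modulo 2

indicator : ∀ {P : Set} → Dec P → Parity
indicator (yes _) = 1ℙ
indicator (no  _) = 0ℙ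

indicator≡1⇔ : ∀ {P : Set} (P? : Dec P) → indicator P? ≡ 1ℙ ⇔ P
indicator≡1⇔ (yes p) = mk⇔ (const p) (const refl)
indicator≡1⇔ (no ¬p) = mk⇔ (λ ()) (λ p → contradiction p ¬p)

≡1⇔≡1⇒≡ : ∀ {p q} → p ≡ 1ℙ ⇔ q ≡ 1ℙ → p ≡ q
≡1⇔≡1⇒≡ {0ℙ} {0ℙ} _ = refl
≡1⇔≡1⇒≡ {0ℙ} {1ℙ} e = Equivalence.from e refl
≡1⇔≡1⇒≡ {1ℙ} {0ℙ} e = sym (Equivalence.to e refl)
≡1⇔≡1⇒≡ {1ℙ} {1ℙ} _ = refl

times-1ℙ≡0ℙ⇒2∣ : ∀ n → n timesℙ 1ℙ ≡ 0ℙ → 2 ∣ n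
times-1ℙ≡0ℙ⇒2∣ zero          _  = 2 ∣0
-- For `suc zero` the hypothesis would read `1ℙ ≡ 0ℙ`. In this clause `1ℙ + p` computes to `p ⁻¹`,
-- so two summands `1ℙ` cancel by involutivity.
times-1ℙ≡0ℙ⇒2∣ (suc (suc n)) eq =
  ∣m∣n⇒∣m+n (∣-refl {2}) (times-1ℙ≡0ℙ⇒2∣ n (trans (sym (ℙ.⁻¹-involutive _)) eq))

sum-zero : ∀ {n} (f : Fin n → Parity) → (∀ i → f i ≡ 0ℙ) → sum f ≡ 0ℙ
sum-zero {n} f f≗0 = trans (sum-cong-≗ f≗0) (sum-replicate-zero n)

sum-single : ∀ {n} (f : Fin n → Parity) k → (∀ i → i ≢ k → f i ≡ 0ℙ) → sum f ≡ f k
sum-single {suc n} f k zero-off-k = begin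
  sum f     ≡⟨ sum-remove {i = k} f ⟩
  f k + _   ≡⟨ cong (λ s → f k + s) (sum-zero _ (λ j → zero-off-k _ (punchInᵢ≢i k j))) ⟩
  f k + 0ℙ  ≡⟨ ℙ.+-identityʳ (f k) ⟩
  f k       ∎

-- The terms with σ i < i and those with i < σ i have the same sum.
sum-involution : ∀ {n} (σ : Fin n → Fin n) → (∀ i → σ (σ i) ≡ i) →
                 (f : Fin n → Parity) → (∀ i → f (σ i) ≡ f i) →
                 sum f ≡ sum (λ i → indicator (σ i Fin.≟ i) * f i)
sum-involution σ σσ≗id f f∘σ≗f = begin
  sum f                                      ≡⟨ sum-cong-≗ trichotomy ⟩
  sum (λ i → above i + (below i + fixed i))  ≡⟨ ∑-distrib-+ above _ ⟩
  sum above + sum (λ i → below i + fixed i)  ≡⟨ cong (λ s → sum above + s) (∑-distrib-+ below fixed) ⟩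
  sum above + (sum below + sum fixed)        ≡⟨ cong (λ s → s + (sum below + sum fixed)) above≡below ⟩
  sum below + (sum below + sum fixed)        ≡⟨ ℙ.+-assoc (sum below) (sum below) (sum fixed) ⟨
  (sum below + sum below) + sum fixed        ≡⟨ cong (λ s → s + sum fixed) (p+p≡0ℙ (sum below)) ⟩
  sum fixed                                  ∎
  where
  above = λ i → indicator (σ i Fin.<? i) * f i
  below = λ i → indicator (i Fin.<? σ i) * f i
  fixed = λ i → indicator (σ i Fin.≟ i) * f i

  trichotomy : ∀ i → f i ≡ above i + (below i + fixed i)
  trichotomy i with σ i Fin.<? i | i Fin.<? σ i | σ i Fin.≟ i
  ... | yes l | yes g | _     = contradiction g (Fin.<-asym l)
  ... | yes l | no _  | yes e = contradiction e (Fin.<⇒≢ l)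
  ... | yes _ | no _  | no _  = sym (ℙ.+-identityʳ (f i))
  ... | no _  | yes g | yes e = contradiction (sym e) (Fin.<⇒≢ g)
  ... | no _  | yes _ | no _  = sym (ℙ.+-identityʳ (f i))
  ... | no _  | no _  | yes _ = refl
  ... | no ¬l | no ¬g | no ¬e with Fin.<-cmp (σ i) i
  ...   | tri< l _ _ = contradiction l ¬l
  ...   | tri≈ _ e _ = contradiction e ¬e
  ...   | tri> _ _ g = contradiction g ¬g

  above≡below : sum above ≡ sum below
  -- Reindexing along `σ` turns the test `σ i < i` into `σ (σ i) < σ i`, that is, `i < σ i`.
  above≡below = trans (sum-permute above (permutation σ σ σσ≗id σσ≗id))
    (sum-cong-≗ λ i → cong₂ (λ j p → indicator (j Fin.<? σ i) * p) (σσ≗id i) (f∘σ≗f i))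

module FiniteSum {V : Set} {n : ℕ} (finite : V ↔ Fin n) where
  open Inverse finite using (to; from; strictlyInverseˡ; strictlyInverseʳ)

  ∑ : (V → Parity) → Parity
  ∑ f = sum (f ∘ from)

  ∑-cong : ∀ {f g} → (∀ v → f v ≡ g v) → ∑ f ≡ ∑ g
  ∑-cong f≗g = sum-cong-≗ (f≗g ∘ from)

  ∑-permute : (π : V ↔ V) (f : V → Parity) → ∑ f ≡ ∑ (f ∘ Inverse.to π)
  ∑-permute π f = trans
    (sum-permute (f ∘ from)
      (permutation (to ∘ π.to ∘ from) (to ∘ π.from ∘ from) inverse-to inverse-from))
    (sum-cong-≗ λ i → cong f (strictlyInverseʳ (π.to (from i))))
    where
    module π = Inverse π
    inverse-to : ∀ i → to (π.to (from (to (π.from (from i))))) ≡ i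
    inverse-to i rewrite strictlyInverseʳ (π.from (from i)) | π.strictlyInverseˡ (from i) =
      strictlyInverseˡ i
    inverse-from : ∀ i → to (π.from (from (to (π.to (from i))))) ≡ i
    inverse-from i rewrite strictlyInverseʳ (π.to (from i)) | π.strictlyInverseʳ (from i) =
      strictlyInverseˡ i

  module _ (σ : V → V) (σσ≗id : ∀ v → σ (σ v) ≡ v)
           (f : V → Parity) (f∘σ≗f : ∀ v → f (σ v) ≡ f v) where

    private
      σ′ : Fin n → Fin n
      σ′ = to ∘ σ ∘ from

      from-σ′ : ∀ i → from (σ′ i) ≡ σ (from i)
      from-σ′ i = strictlyInverseʳ (σ (from i))

      ∑-fixed : ∑ f ≡ sum (λ i → indicator (σ′ i Fin.≟ i) * f (from i))
      ∑-fixed = sum-involution σ′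
        (λ i → trans (cong (to ∘ σ) (from-σ′ i)) (trans (cong to (σσ≗id (from i))) (strictlyInverseˡ i)))
        (f ∘ from) (λ i → trans (cong f (from-σ′ i)) (f∘σ≗f (from i)))

      fixed⇒fixed : ∀ i → σ′ i ≡ i → σ (from i) ≡ from i
      fixed⇒fixed i eq = trans (sym (from-σ′ i)) (cong from eq)

    ∑-fixedPointFree : (∀ v → σ v ≢ v) → ∑ f ≡ 0ℙ
    ∑-fixedPointFree σv≢v = trans ∑-fixed (sum-zero _ zero-term)
      where
      zero-term : ∀ i → indicator (σ′ i Fin.≟ i) * f (from i) ≡ 0ℙ
      zero-term i with σ′ i Fin.≟ i
      ... | yes eq = contradiction (fixed⇒fixed i eq) (σv≢v (from i))
      ... | no _   = refl

    -- Moved points cancel in pairs. Fixed points other than `k` are allowed if `f` vanishes there: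
    -- the interchange of steps in `weight-square` fixes one vertex in each layer.
    ∑-fixedPoint : ∀ k → σ k ≡ k → (∀ v → σ v ≡ v → v ≢ k → f v ≡ 0ℙ) → ∑ f ≡ f k
    ∑-fixedPoint k σk≡k zero-off-k = begin
      ∑ f               ≡⟨ ∑-fixed ⟩
      sum g             ≡⟨ sum-single g (to k) zero-term ⟩
      g (to k)          ≡⟨ term-k ⟩
      f (from (to k))   ≡⟨ cong f (strictlyInverseʳ k) ⟩
      f k               ∎
      where
      g : Fin n → Parity
      g i = indicator (σ′ i Fin.≟ i) * f (from i)

      zero-term : ∀ i → i ≢ to k → g i ≡ 0ℙ
      zero-term i i≢k with σ′ i Fin.≟ i
      ... | yes eq = zero-off-k (from i) (fixed⇒fixed i eq)
                       (λ e → i≢k (trans (sym (strictlyInverseˡ i)) (cong to e)))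
      ... | no _   = refl

      term-k : g (to k) ≡ f (from (to k))
      term-k with σ′ (to k) Fin.≟ to k
      ... | yes _ = refl
      ... | no ne = contradiction (cong to (trans (cong σ (strictlyInverseʳ k)) σk≡k)) ne

-- Iteration

module _ {A : Set} where
  open Endo A using (_^_)

  ^-shift : ∀ (f : A → A) n x → (f ^ n) (f x) ≡ f ((f ^ n) x)
  ^-shift f zero    x = refl
  ^-shift f (suc n) x = cong f (^-shift f n x)

  ^-leftInverse : ∀ {f h : A → A} → (∀ x → h (f x) ≡ x) → ∀ n x → (h ^ n) ((f ^ n) x) ≡ x
  ^-leftInverse         hf≗id zero    x = refl
  ^-leftInverse {f} {h} hf≗id (suc n) x = begin
    h ((h ^ n) (f ((f ^ n) x)))  ≡⟨ ^-shift h n _ ⟨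
    (h ^ n) (h (f ((f ^ n) x)))  ≡⟨ cong (h ^ n) (hf≗id _) ⟩
    (h ^ n) ((f ^ n) x)          ≡⟨ ^-leftInverse hf≗id n x ⟩
    x                            ∎

  module _ {f : A → A} (injective : Injective _≡_ _≡_ f) where

    ^-cancelˡ : ∀ m {n x} → (f ^ (m ℕ.+ n)) x ≡ (f ^ m) x → (f ^ n) x ≡ x
    ^-cancelˡ zero    eq = eq
    ^-cancelˡ (suc m) eq = ^-cancelˡ m (injective eq)

    -- By pigeonhole two of the iterates with exponents 0 to `n` coincide, and injectivity cancels
    -- the smaller exponent. Writing the period as `suc p` makes it positive.
    injective⇒periodic : ∀ {n} → A ↔ Fin n → ∀ x → ∃[ p ] (f ^ suc p) x ≡ x
    injective⇒periodic {n} finite x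
      with i , j , i<j , eq ← pigeonhole (ℕ.n<1+n n) (λ i → Inverse.to finite ((f ^ toℕ i) x))
      with p , 1+i+p≡j ← ℕ.m≤n⇒∃[o]m+o≡n i<j
      = p , ^-cancelˡ (toℕ i) (begin
        (f ^ (toℕ i ℕ.+ suc p)) x  ≡⟨ cong (λ m → (f ^ m) x) (trans (ℕ.+-suc (toℕ i) p) 1+i+p≡j) ⟩
        (f ^ toℕ j) x              ≡⟨ Injection.injective (↔⇒↣ finite) eq ⟨
        (f ^ toℕ i) x              ∎)

-- Squaring in cyclic groups of odd order

module _ (G : FiniteGroup) where
  open FiniteGroup G renaming (_^_ to _^ℤ_)
  open Group group using (rawMonoid; assoc; identityˡ; identityʳ; inverseˡ)
  open GroupProperties group
  open RawMonoidMult rawMonoid using () renaming (_×_ to _times_)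

  ⁻¹-commutes : ∀ {x y} → x ∙ y ≡ y ∙ x → x ∙ y ⁻¹ ≡ y ⁻¹ ∙ x
  ⁻¹-commutes {x} {y} xy≡yx = y≈x\\z y (x ∙ y ⁻¹) x (begin
    y ∙ (x ∙ y ⁻¹)  ≡⟨ assoc y x (y ⁻¹) ⟨
    y ∙ x ∙ y ⁻¹    ≡⟨ cong (_∙ y ⁻¹) xy≡yx ⟨
    x ∙ y ∙ y ⁻¹    ≡⟨ //-rightDividesʳ y x ⟩
    x               ∎)

  times-commutes : ∀ {x g} → x ∙ g ≡ g ∙ x → ∀ n → x ∙ (n times g) ≡ (n times g) ∙ x
  times-commutes {x}     xg≡gx zero    = trans (identityʳ x) (sym (identityˡ x))
  times-commutes {x} {g} xg≡gx (suc n) = begin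
    x ∙ (g ∙ (n times g))  ≡⟨ assoc x g _ ⟨
    x ∙ g ∙ (n times g)    ≡⟨ cong (_∙ (n times g)) xg≡gx ⟩
    g ∙ x ∙ (n times g)    ≡⟨ assoc g x _ ⟩
    g ∙ (x ∙ (n times g))  ≡⟨ cong (g ∙_) (times-commutes xg≡gx n) ⟩
    g ∙ ((n times g) ∙ x)  ≡⟨ assoc g _ x ⟨
    g ∙ (n times g) ∙ x    ∎

  ^-commutes : ∀ {x g} → x ∙ g ≡ g ∙ x → ∀ k → x ∙ g ^ℤ k ≡ g ^ℤ k ∙ x
  ^-commutes xg≡gx (+ n)    = times-commutes xg≡gx n
  ^-commutes xg≡gx -[1+ n ] = ⁻¹-commutes (times-commutes xg≡gx (suc n))

  Cyclic⇒comm : Cyclic G → ∀ x y → x ∙ y ≡ y ∙ x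
  Cyclic⇒comm (g , powers) x y with k , refl ← powers x | l , refl ← powers y =
    -- As `g` commutes with itself, it commutes with `g ^ℤ k`; hence `g ^ℤ k` commutes with every
    -- power of `g`.
    ^-commutes (sym (^-commutes refl k)) l

  module _ {f : Carrier → Carrier} (homo : ∀ x y → f (x ∙ y) ≡ f x ∙ f y) where

    homo-ε : f ε ≡ ε
    homo-ε = identityˡ-unique (f ε) (f ε) (trans (sym (homo ε ε)) (cong f (identityˡ ε)))

    homo-⁻¹ : ∀ x → f (x ⁻¹) ≡ f x ⁻¹
    homo-⁻¹ x = inverseˡ-unique (f (x ⁻¹)) (f x)
      (trans (sym (homo (x ⁻¹) x)) (trans (cong f (inverseˡ x)) homo-ε))

    homo-times : ∀ n x → f (n times x) ≡ n times f x
    homo-times zero    x = homo-ε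
    homo-times (suc n) x = trans (homo x (n times x)) (cong (f x ∙_) (homo-times n x))

    homo-^ : ∀ k x → f (x ^ℤ k) ≡ f x ^ℤ k
    homo-^ (+ n)    x = homo-times n x
    homo-^ -[1+ n ] x = trans (homo-⁻¹ (suc n times x)) (cong _⁻¹ (homo-times (suc n) x))

module OddCyclic (G : FiniteGroup) (cyclic : Cyclic G) (odd : ¬ (2 ∣ FiniteGroup.order G)) where
  open FiniteGroup G renaming (_^_ to _^ℤ_)
  open Endo Carrier using (_^_)

  abelianGroup : AbelianGroup 0ℓ 0ℓ
  abelianGroup = record
    { isAbelianGroup = record { isGroup = isGroup ; comm = Cyclic⇒comm G cyclic } }

  open AbelianGroup abelianGroup using (assoc; comm; identityˡ; commutativeSemigroup)
  open AbelianGroupProperties abelianGroup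
  open CommutativeSemigroupProperties commutativeSemigroup using (interchange)

  square : Carrier → Carrier
  square x = x ∙ x

  square-homo : ∀ x y → square (x ∙ y) ≡ square x ∙ square y
  square-homo x y = interchange x y x y

  -- Multiplication by z is a fixed-point-free involution unless z ≡ ε.
  square≡ε⇒≡ε : ∀ z → square z ≡ ε → z ≡ ε
  square≡ε⇒≡ε z zz≡ε = decidable-stable (inj⇒≟ (↔⇒↣ finite) z ε) λ z≢ε →
    odd (times-1ℙ≡0ℙ⇒2∣ order (begin
      order timesℙ 1ℙ  ≡⟨ sum-replicate order ⟨
      ∑ (const 1ℙ)     ≡⟨ ∑-fixedPointFree (z ∙_) z∙-involutive (const 1ℙ) (λ _ → refl)
                            (λ v zv≡v → z≢ε (identityˡ-unique z v zv≡v)) ⟩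
      0ℙ               ∎))
    where
    open FiniteSum finite
    z∙-involutive : ∀ v → z ∙ (z ∙ v) ≡ v
    z∙-involutive v = trans (sym (assoc z z v)) (trans (cong (_∙ v) zz≡ε) (identityˡ v))

  square-injective : Injective _≡_ _≡_ square
  square-injective {x} {y} xx≡yy = x∙y⁻¹≈ε⇒x≈y x y (square≡ε⇒≡ε (x ∙ y ⁻¹) (begin
    square (x ∙ y ⁻¹)           ≡⟨ square-homo x (y ⁻¹) ⟩
    square x ∙ (y ⁻¹ ∙ y ⁻¹)    ≡⟨ cong (square x ∙_) (⁻¹-∙-comm y y) ⟩
    square x ∙ square y ⁻¹      ≡⟨ x≈y⇒x∙y⁻¹≈ε xx≡yy ⟩
    ε                           ∎))

  square^-homo : ∀ n x y → (square ^ n) (x ∙ y) ≡ (square ^ n) x ∙ (square ^ n) y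
  square^-homo zero    x y = refl
  square^-homo (suc n) x y = trans (cong square (square^-homo n x y)) (square-homo _ _)

  -- Iterates of `square` are endomorphisms, so one that fixes a generator is the identity. The
  -- period of the generator therefore serves for all elements at once.
  square-periodic : ∃[ p ] ∀ x → (square ^ suc p) x ≡ x
  square-periodic = proj₁ periodic , λ x → let k , x≡gᵏ = proj₂ cyclic x in begin
    (square ^ suc (proj₁ periodic)) x         ≡⟨ cong (square ^ suc (proj₁ periodic)) x≡gᵏ ⟩
    (square ^ suc (proj₁ periodic)) (g ^ℤ k)  ≡⟨ homo-^ G (square^-homo (suc (proj₁ periodic))) k g ⟩
    (square ^ suc (proj₁ periodic)) g ^ℤ k    ≡⟨ cong (_^ℤ k) (proj₂ periodic) ⟩
    g ^ℤ k                                    ≡⟨ x≡gᵏ ⟨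
    x                                         ∎
    where
    g = proj₁ cyclic
    periodic = injective⇒periodic square-injective finite g

  period : ℕ
  period = proj₁ square-periodic

  -- One squaring fewer than a full period: the inverse of `square`.
  √ : Carrier → Carrier
  √ = square ^ period

  square-√ : ∀ x → square (√ x) ≡ x
  square-√ = proj₂ square-periodic

  √-square : ∀ x → √ (square x) ≡ x
  √-square x = square-injective (square-√ (square x))

  -- An inverse has the same period. This brings `χ ∘ √ ∘ ... ∘ √` back to `χ` after `suc period`
  -- squarings of the matrix.
  √-periodic : ∀ x → (√ ^ suc period) x ≡ x
  √-periodic x = trans (cong (√ ^ suc period) (sym (square-√ x)))
    (^-leftInverse {f = square} {h = √} √-square (suc period) x)

  -- Walks of length two and squares of adjacency matrices over F₂

  telescope : ∀ x z y → (x ⁻¹ ∙ z) ∙ (z ⁻¹ ∙ y) ≡ x ⁻¹ ∙ y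
  telescope x z y = begin
    (x ⁻¹ ∙ z) ∙ (z ⁻¹ ∙ y)  ≡⟨ assoc (x ⁻¹) z _ ⟩
    x ⁻¹ ∙ (z ∙ (z ⁻¹ ∙ y))  ≡⟨ cong (x ⁻¹ ∙_) (\\-leftDividesˡ z y) ⟩
    x ⁻¹ ∙ y                 ∎

  -- x, reflect z, y is the walk x, z, y with its two steps interchanged.
  module Reflection (x y : Carrier) where

    reflect : Carrier → Carrier
    reflect z = x ∙ (z ⁻¹ ∙ y)

    reflect-step₁ : ∀ z → x ⁻¹ ∙ reflect z ≡ z ⁻¹ ∙ y
    reflect-step₁ z = \\-leftDividesʳ x (z ⁻¹ ∙ y)

    reflect-step₂ : ∀ z → reflect z ⁻¹ ∙ y ≡ x ⁻¹ ∙ z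
    -- Both walks from `x` to `y` have the same product of steps, so in an abelian group the first
    -- step of the reflected walk determines its second.
    reflect-step₂ z = ∙-cancelˡ (z ⁻¹ ∙ y) _ _ (begin
      (z ⁻¹ ∙ y) ∙ (reflect z ⁻¹ ∙ y)         ≡⟨ cong (_∙ (reflect z ⁻¹ ∙ y)) (reflect-step₁ z) ⟨
      (x ⁻¹ ∙ reflect z) ∙ (reflect z ⁻¹ ∙ y) ≡⟨ telescope x (reflect z) y ⟩
      x ⁻¹ ∙ y                                ≡⟨ telescope x z y ⟨
      (x ⁻¹ ∙ z) ∙ (z ⁻¹ ∙ y)                 ≡⟨ comm (x ⁻¹ ∙ z) (z ⁻¹ ∙ y) ⟩
      (z ⁻¹ ∙ y) ∙ (x ⁻¹ ∙ z)                 ∎)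

    reflect-involutive : ∀ z → reflect (reflect z) ≡ z
    reflect-involutive z = trans (cong (x ∙_) (reflect-step₂ z)) (\\-leftDividesˡ x z)

    -- The middle vertex of the walk from `x` to `y` with two equal steps.
    midpoint : Carrier
    midpoint = x ∙ √ (x ⁻¹ ∙ y)

    midpoint-step₁ : x ⁻¹ ∙ midpoint ≡ √ (x ⁻¹ ∙ y)
    midpoint-step₁ = \\-leftDividesʳ x (√ (x ⁻¹ ∙ y))

    midpoint-step₂ : midpoint ⁻¹ ∙ y ≡ √ (x ⁻¹ ∙ y)
    midpoint-step₂ = ∙-cancelˡ (√ (x ⁻¹ ∙ y)) _ _ (begin
      √ (x ⁻¹ ∙ y) ∙ (midpoint ⁻¹ ∙ y)       ≡⟨ cong (_∙ (midpoint ⁻¹ ∙ y)) midpoint-step₁ ⟨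
      (x ⁻¹ ∙ midpoint) ∙ (midpoint ⁻¹ ∙ y)  ≡⟨ telescope x midpoint y ⟩
      x ⁻¹ ∙ y                               ≡⟨ square-√ (x ⁻¹ ∙ y) ⟨
      √ (x ⁻¹ ∙ y) ∙ √ (x ⁻¹ ∙ y)            ∎)

    reflect-midpoint : reflect midpoint ≡ midpoint
    reflect-midpoint = cong (x ∙_) midpoint-step₂

    -- A fixed walk has equal steps, and their common value has square `x ⁻¹ ∙ y`; injectivity of
    -- `square` determines it.
    fixed⇒midpoint : ∀ z → reflect z ≡ z → z ≡ midpoint
    fixed⇒midpoint z fixed = begin
      z               ≡⟨ \\-leftDividesˡ x z ⟨
      x ∙ (x ⁻¹ ∙ z)  ≡⟨ cong (x ∙_) (square-injective (begin
        (x ⁻¹ ∙ z) ∙ (x ⁻¹ ∙ z)          ≡⟨ cong (λ w → (x ⁻¹ ∙ z) ∙ (x ⁻¹ ∙ w)) fixed ⟨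
        (x ⁻¹ ∙ z) ∙ (x ⁻¹ ∙ reflect z)  ≡⟨ cong ((x ⁻¹ ∙ z) ∙_) (reflect-step₁ z) ⟩
        (x ⁻¹ ∙ z) ∙ (z ⁻¹ ∙ y)          ≡⟨ telescope x z y ⟩
        x ⁻¹ ∙ y                         ≡⟨ square-√ (x ⁻¹ ∙ y) ⟨
        square (√ (x ⁻¹ ∙ y))            ∎)) ⟩
      midpoint        ∎

  -- weight c χ is the adjacency matrix over F₂ of the Cayley graph on G × ℤ₂
  -- with connection set {(s , c) : χ s ≡ 1ℙ}; the factor c + (i + j) + 1ℙ says that i + j ≡ c.
  weight : Parity → (Carrier → Parity) → Carrier × Parity → Carrier × Parity → Parity
  weight c χ (x , i) (y , j) = (c + (i + j) + 1ℙ) * χ (x ⁻¹ ∙ y)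

  module _ {n} (finiteV : (Carrier × Parity) ↔ Fin n) where
    open FiniteSum finiteV

    -- This is the Frobenius map of the group algebra F₂[G × ℤ₂].
    weight-square : ∀ c χ u v → ∑ (λ w → weight c χ u w * weight c χ w v) ≡ weight 0ℙ (χ ∘ √) u v
    weight-square c χ (x , i) (y , j) = trans
      -- The reflection keeps the layer `k` of the middle vertex. Each step adds `c` to the layer,
      -- so the surviving middle vertex lies in layer `i + c` and the walk ends in layer
      -- `i + c + c`, which is `i`: hence the index `0ℙ`.
      (∑-fixedPoint (λ (z , k) → reflect z , k) (λ (z , k) → cong (_, k) (reflect-involutive z))
        f f-reflect (midpoint , i + c) (cong (_, i + c) reflect-midpoint) f-zero)
      f-midpoint
      where
      open Reflection x y
      f : Carrier × Parity → Parity
      f w = weight c χ (x , i) w * weight c χ w (y , j)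

      swap-factors : ∀ a b p q → (a * p) * (b * q) ≡ (a * q) * (b * p)
      swap-factors 0ℙ b  p q = refl
      swap-factors 1ℙ 0ℙ p q = trans (ℙ.*-zeroʳ p) (sym (ℙ.*-zeroʳ q))
      swap-factors 1ℙ 1ℙ p q = ℙ.*-comm p q

      f-reflect : ∀ w → f (reflect (proj₁ w) , proj₂ w) ≡ f w
      f-reflect (z , k) rewrite reflect-step₁ z | reflect-step₂ z =
        swap-factors (c + (i + k) + 1ℙ) (c + (k + j) + 1ℙ) (χ (z ⁻¹ ∙ y)) (χ (x ⁻¹ ∙ z))

      level : ∀ c i k → c + (i + k) + 1ℙ ≡ 0ℙ ⊎ k ≡ i + c
      level 0ℙ 0ℙ 0ℙ = inj₂ refl
      level 0ℙ 0ℙ 1ℙ = inj₁ refl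
      level 0ℙ 1ℙ 0ℙ = inj₁ refl
      level 0ℙ 1ℙ 1ℙ = inj₂ refl
      level 1ℙ 0ℙ 0ℙ = inj₁ refl
      level 1ℙ 0ℙ 1ℙ = inj₂ refl
      level 1ℙ 1ℙ 0ℙ = inj₂ refl
      level 1ℙ 1ℙ 1ℙ = inj₁ refl

      f-zero : ∀ w → (reflect (proj₁ w) , proj₂ w) ≡ w → w ≢ (midpoint , i + c) → f w ≡ 0ℙ
      f-zero (z , k) fixed w≢m with level c i k
      -- A middle vertex in the wrong layer makes the first weight vanish.
      ... | inj₁ c≢i+k rewrite c≢i+k = refl
      ... | inj₂ k≡i+c = contradiction (cong₂ _,_ (fixed⇒midpoint z (cong proj₁ fixed)) k≡i+c) w≢m

      -- Coefficients lie in F₂, where `p * p ≡ p`, so squaring leaves the value of `χ` unchanged.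
      factors : ∀ c i j p → ((c + (i + (i + c)) + 1ℙ) * p) * ((c + (i + c + j) + 1ℙ) * p) ≡ (i + j + 1ℙ) * p
      factors 0ℙ 0ℙ 0ℙ p = ℙ.*-idem p
      factors 0ℙ 0ℙ 1ℙ p = ℙ.*-zeroʳ p
      factors 0ℙ 1ℙ 0ℙ p = ℙ.*-zeroʳ p
      factors 0ℙ 1ℙ 1ℙ p = ℙ.*-idem p
      factors 1ℙ 0ℙ 0ℙ p = ℙ.*-idem p
      factors 1ℙ 0ℙ 1ℙ p = ℙ.*-zeroʳ p
      factors 1ℙ 1ℙ 0ℙ p = ℙ.*-zeroʳ p
      factors 1ℙ 1ℙ 1ℙ p = ℙ.*-idem p

      f-midpoint : f (midpoint , i + c) ≡ weight 0ℙ (χ ∘ √) (x , i) (y , j)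
      f-midpoint rewrite midpoint-step₁ | midpoint-step₂ = factors c i j (χ (√ (x ⁻¹ ∙ y)))

    module _ (π : (Carrier × Parity) ↔ (Carrier × Parity)) where
      open Inverse π using (to)

      Invariant : (Carrier × Parity → Carrier × Parity → Parity) → Set
      Invariant M = ∀ u v → M (to u) (to v) ≡ M u v

      -- A permutation matrix that commutes with `M` commutes with the square of `M`; in terms of
      -- entries this is reindexing the sum over middle vertices by `π`.
      weight-square-invariant : ∀ c χ → Invariant (weight c χ) → Invariant (weight 0ℙ (χ ∘ √))
      weight-square-invariant c χ inv u v = begin
        weight 0ℙ (χ ∘ √) (to u) (to v)                ≡⟨ weight-square c χ (to u) (to v) ⟨
        ∑ (λ w → M (to u) w * M w (to v))              ≡⟨ ∑-permute π (λ w → M (to u) w * M w (to v)) ⟩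
        ∑ (λ w → M (to u) (to w) * M (to w) (to v))    ≡⟨ ∑-cong (λ w → cong₂ _*_ (inv u w) (inv w v)) ⟩
        ∑ (λ w → M u w * M w v)                        ≡⟨ weight-square c χ u v ⟩
        weight 0ℙ (χ ∘ √) u v                          ∎
        where M = weight c χ

      -- The first squaring replaces `c` by `0ℙ`, and later ones keep it there. Counting `suc n`
      -- squarings guarantees that first one.
      weight-iterate-invariant : ∀ n c χ → Invariant (weight c χ) → Invariant (weight 0ℙ (χ ∘ (√ ^ suc n)))
      weight-iterate-invariant zero    c χ inv = weight-square-invariant c χ inv
      weight-iterate-invariant (suc n) c χ inv =
        weight-iterate-invariant n 0ℙ (χ ∘ √) (weight-square-invariant c χ inv)

      -- After a full period of squarings `χ` has returned to itself, while the layer component `c`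
      -- has become `0ℙ` for good.
      weight-invariant : ∀ c χ → Invariant (weight c χ) → Invariant (weight 0ℙ χ)
      weight-invariant c χ inv u v = begin
        weight 0ℙ χ (to u) (to v)                       ≡⟨ weight-periodic (to u) (to v) ⟨
        weight 0ℙ (χ ∘ (√ ^ suc period)) (to u) (to v)  ≡⟨ weight-iterate-invariant period c χ inv u v ⟩
        weight 0ℙ (χ ∘ (√ ^ suc period)) u v            ≡⟨ weight-periodic u v ⟩
        weight 0ℙ χ u v                                 ∎
        where
        weight-periodic : ∀ u v → weight 0ℙ (χ ∘ (√ ^ suc period)) u v ≡ weight 0ℙ χ u v
        weight-periodic (x , i) (y , j) = cong (λ g → (i + j + 1ℙ) * χ g) (√-periodic (x ⁻¹ ∙ y))

-- Automorphisms of double covers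

SameLayerAdj : (X : Graph) → Graph.Vertex X × Parity → Graph.Vertex X × Parity → Set
SameLayerAdj X (x , i) (y , j) = Graph.Adj X x y × i ≡ j

-- Says that `φ` is also an automorphism of two disjoint copies of `X`. That whole layers go to
-- whole layers needs connectedness, in `layer-constant`.
PreservesLayers : (X : Graph) → Automorphism (B X) → Set
PreservesLayers X φ = ∀ u v → SameLayerAdj X u v ⇔ SameLayerAdj X (to u) (to v)
  where open Automorphism φ

≢⇒≡+1 : ∀ {p q : Parity} → p ≢ q → p ≡ 1ℙ + q
≢⇒≡+1 {0ℙ} {0ℙ} p≢q = contradiction refl p≢q
≢⇒≡+1 {0ℙ} {1ℙ} p≢q = refl
≢⇒≡+1 {1ℙ} {0ℙ} p≢q = refl
≢⇒≡+1 {1ℙ} {1ℙ} p≢q = contradiction refl p≢q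

module DoubleCover (X : Graph) (x₀ : Graph.Vertex X)
                   (connected : Connected X) (irreducible : Irreducible X)
                   (layers : ∀ φ → PreservesLayers X φ) where
  open Graph X
  open Automorphism using (to; from; preserves; strictlyInverseˡ; strictlyInverseʳ)
  open Equivalence using () renaming (to to ⇒; from to ⇐)
  module AutB = Group (Aut (B X))

  -- Follow a path from `x` to `y` inside layer `i`: by `layers`, the image of each edge stays
  -- within one layer.
  layer-constant : ∀ φ i x y → proj₂ (to φ (x , i)) ≡ proj₂ (to φ (y , i))
  layer-constant φ i x y = fold (λ x y → proj₂ (to φ (x , i)) ≡ proj₂ (to φ (y , i)))
    (λ x~z → trans (proj₂ (⇒ (layers φ _ _) (x~z , refl)))) refl (connected x y)

  shift : Automorphism (B X) → Parity
  shift φ = proj₂ (to φ (x₀ , 0ℙ))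

  base : Automorphism (B X) → Vertex → Vertex
  base φ x = proj₁ (to φ (x , 0ℙ))

  -- If both layers had images in the same layer, the inverse of `φ`, which is also constant on
  -- layers, would send that layer to both `0ℙ` and `1ℙ`.
  layers-distinct : ∀ φ x y → proj₂ (to φ (x , 1ℙ)) ≢ proj₂ (to φ (y , 0ℙ))
  layers-distinct φ x y eq with () ← begin
    1ℙ                                           ≡⟨ cong proj₂ (strictlyInverseʳ φ (x , 1ℙ)) ⟨
    proj₂ (from φ (to φ (x , 1ℙ)))               ≡⟨ layer-constant (φ AutB.⁻¹) _ _ _ ⟩
    proj₂ (from φ (x₀ , proj₂ (to φ (x , 1ℙ))))  ≡⟨ cong (λ i → proj₂ (from φ (x₀ , i))) eq ⟩
    proj₂ (from φ (x₀ , proj₂ (to φ (y , 0ℙ))))  ≡⟨ layer-constant (φ AutB.⁻¹) _ _ _ ⟩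
    proj₂ (from φ (to φ (y , 0ℙ)))               ≡⟨ cong proj₂ (strictlyInverseʳ φ (y , 0ℙ)) ⟩
    0ℙ                                           ∎

  layer-to : ∀ φ x i → proj₂ (to φ (x , i)) ≡ i + shift φ
  layer-to φ x 0ℙ = layer-constant φ 0ℙ x x₀
  layer-to φ x 1ℙ = ≢⇒≡+1 (layers-distinct φ x x₀)

  -- Both sides amount to adjacency of `x` and `y`: the left one through the edges of `B X` between
  -- layers, the right one through the edges inside layer `0ℙ`.
  neighbours-agree : ∀ φ x y → Adj (proj₁ (to φ (x , 1ℙ))) (base φ y) ⇔ Adj (base φ x) (base φ y)
  neighbours-agree φ x y = mk⇔
    (λ e → proj₁ (⇒ (layers φ _ _) (proj₁ (⇐ (preserves φ _ _) (e , layers-distinct φ x y)) , refl)))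
    (λ e → proj₁ (⇒ (preserves φ (x , 1ℙ) (y , 0ℙ))
      (proj₁ (⇐ (layers φ (x , 0ℙ) (y , 0ℙ)) (e , layer-constant φ 0ℙ x y)) , λ ())))

  -- Extends `neighbours-agree`, which tests adjacency only against vertices `base φ y`, to whole
  -- neighbourhoods.
  base-surjective : ∀ φ w → ∃[ y ] base φ y ≡ w
  base-surjective φ w = proj₁ u ,
    cong proj₁ (trans (cong (λ i → to φ (proj₁ u , i)) (sym u-layer)) (strictlyInverseˡ φ (w , shift φ)))
    where
    u = from φ (w , shift φ)
    u-layer : proj₂ u ≡ 0ℙ
    u-layer = ℙ.+-cancelʳ-≡ (shift φ) _ _
      (trans (sym (layer-to φ (proj₁ u) (proj₂ u))) (cong proj₂ (strictlyInverseˡ φ (w , shift φ))))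

  base-layer : ∀ φ x i → proj₁ (to φ (x , i)) ≡ base φ x
  base-layer φ x 0ℙ = refl
  -- Irreducibility only refutes that vertices with equal neighbourhoods are distinct; decidable
  -- equality on a finite set turns this into an equality.
  base-layer φ x 1ℙ = decidable-stable (inj⇒≟ (↔⇒↣ finite) _ _) λ ne →
    irreducible _ _ ne ((λ {w} → ⇒ (agree w)) , (λ {w} → ⇐ (agree w)))
    where
    agree : ∀ w → Adj (proj₁ (to φ (x , 1ℙ))) w ⇔ Adj (base φ x) w
    agree w with y , refl ← base-surjective φ w = neighbours-agree φ x y

  to-split : ∀ φ x i → to φ (x , i) ≡ (base φ x , i + shift φ)
  to-split φ x i = cong₂ _,_ (base-layer φ x i) (layer-to φ x i)

  base-inverse : ∀ φ x → base φ (base (φ AutB.⁻¹) x) ≡ x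
  base-inverse φ x = trans (sym (base-layer φ _ _)) (cong proj₁ (strictlyInverseˡ φ (x , 0ℙ)))

  restrict : Automorphism (B X) → Automorphism X
  restrict φ = record
    { bijection = mk↔ₛ′ (base φ) (base (φ AutB.⁻¹)) (base-inverse φ) (base-inverse (φ AutB.⁻¹))
    ; preserves = λ x y → mk⇔
        (λ e → proj₁ (⇒ (layers φ (x , 0ℙ) (y , 0ℙ)) (e , refl)))
        (λ e → proj₁ (⇐ (layers φ (x , 0ℙ) (y , 0ℙ)) (e , layer-constant φ 0ℙ x y)))
    }

  extend : Automorphism X → Parity → Automorphism (B X)
  extend α t = record
    { bijection = mk↔ₛ′ (λ (x , i) → to α x , i + t) (λ (x , i) → from α x , i + t)
        (λ (x , i) → cong₂ _,_ (strictlyInverseˡ α x) (shift-twice i))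
        (λ (x , i) → cong₂ _,_ (strictlyInverseʳ α x) (shift-twice i))
    ; preserves = λ (x , i) (y , j) → mk⇔
        (λ (e , i≢j) → ⇒ (preserves α x y) e , i≢j ∘ ℙ.+-cancelʳ-≡ t i j)
        (λ (e , ne) → ⇐ (preserves α x y) e , ne ∘ cong (_+ t))
    }
    where
    shift-twice : ∀ i → i + t + t ≡ i
    shift-twice i = trans (ℙ.+-assoc i t t) (trans (cong (λ p → i + p) (p+p≡0ℙ t)) (ℙ.+-identityʳ i))

  split : Automorphism (B X) → Automorphism X × Parity
  split φ = restrict φ , shift φ

  shift-homo : ∀ φ ψ → shift (φ AutB.∙ ψ) ≡ shift φ + shift ψ
  shift-homo φ ψ = trans (layer-to φ _ (shift ψ)) (ℙ.+-comm (shift ψ) (shift φ))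

  split-isGroupIsomorphism : GroupMorphisms.IsGroupIsomorphism
    (Group.rawGroup (Aut (B X))) (Group.rawGroup (Aut X ×ᴳ ℤ₂)) split
  split-isGroupIsomorphism = record
    { isGroupMonomorphism = record
      { isGroupHomomorphism = record
        { isMonoidHomomorphism = record
          { isMagmaHomomorphism = record
            { isRelHomomorphism = record { cong = λ {φ} {ψ} → split-cong {φ} {ψ} }
            ; homo = λ φ ψ → (λ x → base-layer φ _ _) , shift-homo φ ψ
            }
          ; ε-homo = (λ _ → refl) , refl
          }
        -- Inversion in `ℤ₂` is the identity, so the shifts of `φ` and of its inverse have to agree:
        -- each gives `0ℙ` when added to `shift φ`.
        ; ⁻¹-homo = λ φ → (λ _ → refl) , ℙ.+-cancelʳ-≡ (shift φ) _ _
            (trans (sym (shift-homo (φ AutB.⁻¹) φ))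
              (trans (cong proj₂ (strictlyInverseʳ φ (x₀ , 0ℙ))) (sym (p+p≡0ℙ (shift φ)))))
        }
      ; injective = λ {φ} {ψ} (same-base , same-shift) (x , i) → begin
          to φ (x , i)              ≡⟨ to-split φ x i ⟩
          (base φ x , i + shift φ)  ≡⟨ cong₂ _,_ (same-base x) (cong (λ p → i + p) same-shift) ⟩
          (base ψ x , i + shift ψ)  ≡⟨ to-split ψ x i ⟨
          to ψ (x , i)              ∎
      }
    -- `split (extend α t)` computes to `(α , t)` up to equality of maps, since `0ℙ + t` reduces to
    -- `t`; only congruence remains.
    ; surjective = λ (α , t) → extend α t , λ {φ} → split-cong {φ} {extend α t}
    }
    where
    split-cong : ∀ {φ ψ} → φ AutB.≈ ψ → Group._≈_ (Aut X ×ᴳ ℤ₂) (split φ) (split ψ)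
    split-cong φ≈ψ = (λ x → cong proj₁ (φ≈ψ (x , 0ℙ))) , cong proj₂ (φ≈ψ (x₀ , 0ℙ))

-- Application to odd circulants

module _ (G : FiniteGroup) (cyclic : Cyclic G) (C : ConnectionSet G) (odd : OddOrder (Cay G C)) where
  open FiniteGroup G
  open ConnectionSet C
  open OddCyclic G cyclic odd using (weight; weight-invariant)
  private X = Cay G C

  χ : Carrier → Parity
  χ = indicator ∘ S?

  weight-1⇔Adj : ∀ u v → weight 1ℙ χ u v ≡ 1ℙ ⇔ Graph.Adj (B X) u v
  weight-1⇔Adj (x , i) (y , j) = mk⇔ (⇒ i j) (⇐ i j)
    where
    χ⇔S = indicator≡1⇔ (S? (x ⁻¹ ∙ y))
    ⇒ : ∀ i j → weight 1ℙ χ (x , i) (y , j) ≡ 1ℙ → Graph.Adj (B X) (x , i) (y , j)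
    ⇒ 0ℙ 1ℙ e = Equivalence.to χ⇔S e , λ ()
    ⇒ 1ℙ 0ℙ e = Equivalence.to χ⇔S e , λ ()
    ⇐ : ∀ i j → Graph.Adj (B X) (x , i) (y , j) → weight 1ℙ χ (x , i) (y , j) ≡ 1ℙ
    ⇐ 0ℙ 0ℙ (_ , i≢j) = contradiction refl i≢j
    ⇐ 0ℙ 1ℙ (s , _)   = Equivalence.from χ⇔S s
    ⇐ 1ℙ 0ℙ (s , _)   = Equivalence.from χ⇔S s
    ⇐ 1ℙ 1ℙ (_ , i≢j) = contradiction refl i≢j

  weight-0⇔SameLayerAdj : ∀ u v → weight 0ℙ χ u v ≡ 1ℙ ⇔ SameLayerAdj X u v
  weight-0⇔SameLayerAdj (x , i) (y , j) = mk⇔ (⇒ i j) (⇐ i j)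
    where
    χ⇔S = indicator≡1⇔ (S? (x ⁻¹ ∙ y))
    ⇒ : ∀ i j → weight 0ℙ χ (x , i) (y , j) ≡ 1ℙ → SameLayerAdj X (x , i) (y , j)
    ⇒ 0ℙ 0ℙ e = Equivalence.to χ⇔S e , refl
    ⇒ 1ℙ 1ℙ e = Equivalence.to χ⇔S e , refl
    ⇐ : ∀ i j → SameLayerAdj X (x , i) (y , j) → weight 0ℙ χ (x , i) (y , j) ≡ 1ℙ
    ⇐ 0ℙ 0ℙ (s , _) = Equivalence.from χ⇔S s
    ⇐ 1ℙ 1ℙ (s , _) = Equivalence.from χ⇔S s

  -- `weight 1ℙ χ` is the adjacency matrix of `B X` and `weight 0ℙ χ` that of two disjoint copies of
  -- `X`, so `weight-invariant` carries invariance under `φ` from one to the other.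
  odd-circulant-preservesLayers : ∀ φ → PreservesLayers X φ
  odd-circulant-preservesLayers φ u v = mk⇔
    (λ e → Equivalence.to (weight-0⇔SameLayerAdj _ _)
      (trans (invariant u v) (Equivalence.from (weight-0⇔SameLayerAdj u v) e)))
    (λ e → Equivalence.to (weight-0⇔SameLayerAdj u v)
      (trans (sym (invariant u v)) (Equivalence.from (weight-0⇔SameLayerAdj _ _) e)))
    where
    open Automorphism φ
    invariant : ∀ u v → weight 0ℙ χ (to u) (to v) ≡ weight 0ℙ χ u v
    invariant = weight-invariant (Graph.finite (B X)) bijection 1ℙ χ λ u v → ≡1⇔≡1⇒≡
      (⇔-sym (weight-1⇔Adj u v) ⇔-∘ (⇔-sym (preserves u v) ⇔-∘ weight-1⇔Adj (to u) (to v)))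

theorem1p2 : (G : FiniteGroup) → Cyclic G → (C : ConnectionSet G) →
    let X = Cay G C in
    OddOrder X → Connected X → Irreducible X →
    Aut (B X) ≅ (Aut X ×ᴳ ℤ₂)
theorem1p2 G cyclic C odd connected irreducible = split , split-isGroupIsomorphism
  where open DoubleCover (Cay G C) (FiniteGroup.ε G) connected irreducible
               (odd-circulant-preservesLayers G cyclic C odd)
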